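{- Let $H$ be a Hadamard matrix of order $v$ and let $A=\begin{bmatrix}I&H\\H^{\top}&I\end{bmatrix}$. Then the hypergraph $([2v],\ \mathfrak B_A(2v,3,-1)\cup\mathfrak B_A(2v,4,-2))$ is a regular $\operatorname{PBD}(2v,\{3,4\},v^2-v)$.
   Context: A complex $v\times v$ matrix $H$ is called Hadamard (of order $v$) if each of its entries has absolute value $1$ and $HH^*=vI$, where $H^*$ denotes the Hermitian transpose of $H$. $[2v]=\{1,\dots,2v\}$. For an $m\times m$ matrix $A$, $\mathfrak B_A(m,k,a)$ is the set of $k$-subsets $\alpha\subset[m]=\{1,\dots,m\}$ with $\det(A[\alpha])=a$, where $A[\alpha]$ is the principal submatrix of $A$ indexed by $\alpha$. For positive integers $m,\lambda$ and a set $K$ of positive integers, a pairwise balanced design $\operatorname{PBD}(m,K,\lambda)$ is an $m$-vertex hypergraph in which the cardinality of each hyperedge belongs to $K$ and every $2$-subset of vertices is contained in exactly $\lambda$ hyperedges. It is called regular if it is a $1$-design, in the sense that every vertex is contained in the same number of hyperedges.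
   Formalization: The Hadamard matrix H is assumed to have real entries (±1); for complex Hadamard matrices the claim is false, e.g. for v = 2 and H = i[[1,1],[1,-1]] there are no hyperedges although v²-v = 2. -}

module Defs where

open import Level using (Level; _⊔_; suc; 0ℓ)
open import Algebra.Apartness.Bundles using (HeytingCommutativeRing; HeytingField)
open import Algebra.Bundles using (CommutativeRing; Semiring)
open import Algebra.Bundles.Raw using (RawRing)
import Algebra.Definitions.RawSemiring as RawSemiringDefs
open import Data.Bool.Base using (true; false; if_then_else_)
open import Data.Fin.Base as Fin using (Fin; punchIn)
open import Data.Fin.Properties using (_≟_)
open import Data.Fin.Subset using (Subset; ∣_∣; _⊆_) renaming (_∈_ to _∈ₛ_)
open import Data.List.Base using (List; length)
open import Data.List.Membership.Propositional using (_∈_)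
open import Data.List.Relation.Unary.Unique.Propositional using (Unique)
open import Data.Nat.Base as ℕ using (ℕ)
open import Data.Product.Base using (Σ-syntax; ∃-syntax; _×_)
open import Data.Sum.Base using (_⊎_)
open import Data.Vec.Base using ([]; _∷_)
open import Data.Vec.Functional using (Vector; transpose; zipWith; _++_)
open import Function.Bundles using (_⇔_)
open import Relation.Binary.Core using (Rel)
open import Relation.Binary.PropositionalEquality.Core using (_≡_)
open import Relation.Binary.Structures using (IsStrictPartialOrder)
open import Relation.Nullary.Decidable.Core using (does)
open import Relation.Nullary.Negation.Core using (¬_)
open import Relation.Unary using (Pred)

private
  variable
    a ℓ ℓ₁ ℓ₂ : Level
    m n k p q : ℕ

-- The standard library has no real numbers, so they enter through their
-- axioms: Archimedean, Cauchy-complete ordered fields. Classically these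
-- determine ℝ up to isomorphism; constructively, Bishop's reals are a model.
record RealNumbers c ℓ₁ ℓ₂ : Set (suc (c ⊔ ℓ₁ ⊔ ℓ₂)) where
  field
    heytingField : HeytingField c ℓ₁ ℓ₂

  open HeytingField heytingField public

  open HeytingCommutativeRing heytingCommutativeRing public
    using (commutativeRing)
  open CommutativeRing commutativeRing public using (semiring)
  open RawSemiringDefs (Semiring.rawSemiring semiring) public using () renaming (_×_ to _×ᴿ_)

  infix 4 _<_
  field
    _<_                  : Rel Carrier ℓ₂
    isStrictPartialOrder : IsStrictPartialOrder _≈_ _<_
    #⇔<⊎>                : ∀ x y → x # y ⇔ (x < y ⊎ y < x)
    +-monoˡ-<            : ∀ {x y} z → x < y → x + z < y + z
    *-pos                : ∀ {x y} → 0# < x → 0# < y → 0# < x * y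
    archimedean          : ∀ x → ∃[ n ] x < n ×ᴿ 1#

  -- Since i and j range symmetrically, this bounds the absolute value of
  -- the difference.
  IsCauchy : (ℕ → Carrier) → Set (c ⊔ ℓ₂)
  IsCauchy s = ∀ ε → 0# < ε →
    ∃[ N ] ∀ i j → N ℕ.≤ i → N ℕ.≤ j → s i - s j < ε

  _ConvergesTo_ : (ℕ → Carrier) → Carrier → Set (c ⊔ ℓ₂)
  s ConvergesTo l = ∀ ε → 0# < ε →
    ∃[ N ] ∀ i → N ℕ.≤ i → (s i - l < ε) × (l - s i < ε)

  field
    complete : ∀ s → IsCauchy s → ∃[ l ] s ConvergesTo l

elements : (α : Subset n) → Vector (Fin n) ∣ α ∣
elements (true  ∷ α) Fin.zero    = Fin.zero
elements (true  ∷ α) (Fin.suc i) = Fin.suc (elements α i)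
elements (false ∷ α) i           = Fin.suc (elements α i)

module ComplexMatrices {c ℓ₁ ℓ₂} (R : RealNumbers c ℓ₁ ℓ₂) where

  private
    module ℝ = RealNumbers R

  infixl 6 _+i_
  record ℂ : Set c where
    constructor _+i_
    field
      re im : ℝ.Carrier

  open ℂ public

  infix  8 -_
  infixl 7 _*_
  infixl 6 _+_
  infix  4 _≈_

  _≈_ : Rel ℂ ℓ₁
  z ≈ w = re z ℝ.≈ re w × im z ℝ.≈ im w

  _+_ _*_ : ℂ → ℂ → ℂ
  z + w = (re z ℝ.+ re w) +i (im z ℝ.+ im w)
  z * w = (re z ℝ.* re w ℝ.- im z ℝ.* im w) +i (re z ℝ.* im w ℝ.+ im z ℝ.* re w)

  -_ conj : ℂ → ℂ
  - z    = (ℝ.- re z) +i (ℝ.- im z)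
  conj z = re z +i (ℝ.- im z)

  ℂ-rawRing : RawRing c ℓ₁
  ℂ-rawRing = record
    { Carrier = ℂ
    ; _≈_     = _≈_
    ; _+_     = _+_
    ; _*_     = _*_
    ; -_      = -_
    ; 0#      = ℝ.0# +i ℝ.0#
    ; 1#      = ℝ.1# +i ℝ.0#
    }

  open RawRing ℂ-rawRing public using (0#; 1#)
  open RawSemiringDefs (RawRing.rawSemiring ℂ-rawRing) public
    using (sum; _^_) renaming (_×_ to _×ℂ_)

  ι : ℕ → ℂ
  ι n = n ×ℂ 1#

  -- r is the non-negative square root of |z|² = (re z)² + (im z)²;
  -- ¬ (r < 0) is the constructive r ≥ 0.
  ∣_∣≈_ : ℂ → ℝ.Carrier → Set (ℓ₁ ⊔ ℓ₂)
  ∣ z ∣≈ r = ¬ (r ℝ.< ℝ.0#) × r ℝ.* r ℝ.≈ re z ℝ.* re z ℝ.+ im z ℝ.* im z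

  Matrix : ℕ → ℕ → Set c
  Matrix m n = Vector (Vector ℂ n) m

  infix  4 _≋_
  infixl 7 _·_
  infixr 7 _∙_
  infix  9 _ᵀ _ᴴ

  _≋_ : Rel (Matrix m n) ℓ₁
  P ≋ Q = ∀ i j → P i j ≈ Q i j

  I : Matrix n n
  I i j = if does (i ≟ j) then 1# else 0#

  _∙_ : ℂ → Matrix m n → Matrix m n
  (z ∙ P) i j = z * P i j

  _·_ : Matrix m n → Matrix n k → Matrix m k
  (P · Q) i j = sum (λ l → P i l * Q l j)

  _ᵀ _ᴴ : Matrix m n → Matrix n m
  P ᵀ = transpose P
  (P ᴴ) i j = conj (P j i)

  ⟦_,_∣_,_⟧ : Matrix m p → Matrix m q → Matrix n p → Matrix n q →
              Matrix (m ℕ.+ n) (p ℕ.+ q)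
  ⟦ P , Q ∣ S , T ⟧ = zipWith _++_ P Q ++ zipWith _++_ S T

  -- Laplace expansion along the first row.
  det : Matrix n n → ℂ
  det {ℕ.zero}  P = 1#
  det {ℕ.suc n} P = sum λ j →
    (- 1#) ^ Fin.toℕ j * (P Fin.zero j * det (λ k l → P (Fin.suc k) (punchIn j l)))

  _[_] : Matrix n n → (α : Subset n) → Matrix ∣ α ∣ ∣ α ∣
  (P [ α ]) i j = P (elements α i) (elements α j)

  𝔅 : Matrix m m → ℕ → ℂ → Pred (Subset m) ℓ₁
  𝔅 P k z α = ∣ α ∣ ≡ k × det (P [ α ]) ≈ z

  record IsHadamard (H : Matrix n n) : Set (ℓ₁ ⊔ ℓ₂) where
    field
      unimodular : ∀ i j → ∣ H i j ∣≈ ℝ.1#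
      orthogonal : H · H ᴴ ≋ ι n ∙ I

  IsReal : Matrix m n → Set ℓ₁
  IsReal P = ∀ i j → im (P i j) ℝ.≈ ℝ.0#

-- Predicates are not assumed decidable or proof-irrelevant, so cardinality
-- is witnessed by a repetition-free list of exactly the elements satisfying P.
HasCardinality : {A : Set a} → Pred A ℓ → ℕ → Set (a ⊔ ℓ)
HasCardinality {A = A} P n =
  Σ[ xs ∈ List A ] Unique xs × (∀ x → x ∈ xs ⇔ P x) × length xs ≡ n

-- A hypergraph on m vertices is given by its set of hyperedges.
Hypergraph : ℕ → ∀ ℓ → Set (suc ℓ)
Hypergraph m ℓ = Pred (Subset m) ℓ

-- The index d (usually called λ) is allowed to be 0, which only
-- admits the degenerate case of a design covering no pair.
record IsPBD (m : ℕ) (K : Pred ℕ 0ℓ) (d : ℕ) (E : Hypergraph m ℓ) : Set ℓ where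
  field
    sizes    : ∀ e → E e → K ∣ e ∣
    balanced : ∀ s → ∣ s ∣ ≡ 2 → HasCardinality (λ e → E e × s ⊆ e) d

IsRegular : Hypergraph m ℓ → Set ℓ
IsRegular E = ∃[ r ] ∀ x → HasCardinality (λ e → E e × x ∈ₛ e) r

-- H has entries ±1, so a vertex set with a row indices and b column indices
-- has principal submatrix [[I, M], [Mᵀ, I]] with M an a × b sign matrix.
-- Evaluating the determinants for a + b = 3 and a + b = 4 shows that the edges
-- are exactly the sets with (a, b) among (2,1), (1,2), (3,1) and (1,3); for
-- (2,2) the determinant is 1 or -3, never -2.
-- The numbers of edges through a pair and through a point are then sums of
-- products of binomial coefficients.
module Submission where

open import Defs
open import Data.Nat.Base as ℕ using (ℕ; zero; suc; NonZero; _∸_; _≤_; s≤s)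
open import Data.Product.Base
  using (∃-syntax; _×_; _,_; proj₁; proj₂; uncurry; map₁)
open import Relation.Unary using (Pred; ｛_｝; _∪_)
import Algebra.Apartness.Properties.HeytingCommutativeRing as HeytingProperties
open import Algebra.Bundles using (Ring; CommutativeRing)
import Algebra.Definitions.RawSemiring as RawSemiringDefs
import Algebra.Properties.Ring as RingProperties
import Algebra.Properties.Semiring.Mult as Mult
open import Data.Bool.Base using (true; false; if_then_else_)
open import Data.Fin.Base as Fin using (Fin; punchIn; cast)
open import Data.Fin.Patterns using (0F; 1F; 2F)
open import Data.Fin.Properties using (_≟_; cast-is-id; suc-injective)
open import Data.Fin.Subset using (Subset; ∣_∣; _⊆_; ∁; ⁅_⁆; inside; outside)
  renaming (_∈_ to _∈ₛ_)
open import Data.Fin.Subset.Properties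
  using (drop-∷-⊆; out⊆-⇔; in⊆in-⇔; x∈⁅x⁆; x∈⁅y⁆⇒x≡y; ∣⁅x⁆∣≡1; ∣∁p∣≡n∸∣p∣; ∣p∣≤n)
open import Data.Integer.Base as ℤ using (ℤ; +_; -[1+_]; _⊖_; _◃_; 0ℤ; 1ℤ; -1ℤ)
import Data.Integer.Properties as ℤ
open import Data.List.Base as List using (List; []; _∷_; length; map)
open import Data.List.Membership.Propositional using (_∈_)
open import Data.List.Membership.Propositional.Properties
  using (∈-map⁺; ∈-map⁻; ∈-++⁺ˡ; ∈-++⁺ʳ; ∈-++⁻; ∈-cartesianProduct⁺; ∈-cartesianProduct⁻)
open import Data.List.Properties using (length-map; length-++)
open import Data.List.Relation.Unary.All as All using ([]; _∷_)
open import Data.List.Relation.Unary.AllPairs using ([]; _∷_)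
open import Data.List.Relation.Unary.Any using (here; there)
open import Data.List.Relation.Unary.Unique.Propositional using (Unique)
import Data.List.Relation.Unary.Unique.Propositional.Properties as Unique
open import Data.Nat.Combinatorics using (_C_; nC1≡n; nCk+nC[k+1]≡[n+1]C[k+1])
open import Data.Nat.ListAction using () renaming (sum to sumℕ)
import Data.Nat.Properties as ℕ
open import Data.Nat.Tactic.RingSolver using (solve-∀)
open import Data.Product.Function.NonDependent.Propositional using (_×-⇔_)
open import Data.Product.Properties using (×-≡,≡→≡)
open import Data.Sign.Base as Sign using (Sign)
open import Data.Sum.Base as Sum using (_⊎_; inj₁; inj₂; [_,_]′)
open import Data.Vec.Base as Vec using ([]; _∷_; _++_; here; there)
open import Data.Vec.Properties using (++-injective; ∷-injectiveʳ)
open import Function.Base using (_∘_)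
open import Function.Bundles using (_⇔_; mk⇔; module Equivalence)
open import Function.Construct.Composition using (_⇔-∘_)
open import Function.Construct.Identity using (⇔-id)
open import Level using (Level)
open import Relation.Binary.PropositionalEquality as ≡
  using (_≡_; refl; cong; cong₂; subst; module ≡-Reasoning)
import Relation.Binary.Reasoning.Setoid as SetoidReasoning
open import Relation.Binary.Structures using (IsStrictPartialOrder)
open import Relation.Nullary.Decidable using (does; dec-true; dec-false; yes; no)
open import Relation.Nullary.Negation.Core using (¬_; contradiction)

open Equivalence using (to; from)

private
  variable
    p q : Level
    A B : Set p
    P Q : Pred A p
    l m n : ℕ

-- Cardinalities of unions, images, products and fibres.

HasCardinality-∅ : (∀ x → ¬ P x) → HasCardinality P 0
HasCardinality-∅ ¬P = [] , [] , (λ x → mk⇔ (λ ()) λ Px → contradiction Px (¬P x)) , refl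

HasCardinality-resp-⇔ : HasCardinality P n → (∀ x → P x ⇔ Q x) → HasCardinality Q n
HasCardinality-resp-⇔ (xs , xs! , ∈⇔P , len) P⇔Q =
  xs , xs! , (λ x → P⇔Q x ⇔-∘ ∈⇔P x) , len

HasCardinality-⊎ : HasCardinality P m → HasCardinality Q n → (∀ x → P x → ¬ Q x) →
                   HasCardinality (P ∪ Q) (m ℕ.+ n)
HasCardinality-⊎ (xs , xs! , ∈⇔P , refl) (ys , ys! , ∈⇔Q , refl) P∩Q≡∅ =
  xs List.++ ys
  , Unique.++⁺ xs! ys! (λ (∈xs , ∈ys) → P∩Q≡∅ _ (∈⇔P _ .to ∈xs) (∈⇔Q _ .to ∈ys))
  , (λ x → mk⇔ (Sum.map (∈⇔P x .to) (∈⇔Q x .to) ∘ ∈-++⁻ xs)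
               [ ∈-++⁺ˡ ∘ ∈⇔P x .from , ∈-++⁺ʳ xs ∘ ∈⇔Q x .from ]′)
  , length-++ xs

HasCardinality-map : (f : A → B) → (∀ {x y} → f x ≡ f y → x ≡ y) →
                     HasCardinality P n → HasCardinality (λ y → ∃[ x ] P x × y ≡ f x) n
HasCardinality-map f f-inj (xs , xs! , ∈⇔P , refl) =
  map f xs
  , Unique.map⁺ f-inj xs!
  , (λ y → mk⇔ (λ y∈ → let x , x∈ , y≡fx = ∈-map⁻ f y∈ in x , ∈⇔P x .to x∈ , y≡fx)
               (λ { (x , Px , refl) → ∈-map⁺ f (∈⇔P x .from Px) }))
  , length-map f xs

length-cartesianProduct : (xs : List A) (ys : List B) →
                          length (List.cartesianProduct xs ys) ≡ length xs ℕ.* length ys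
length-cartesianProduct []       ys = refl
length-cartesianProduct (x ∷ xs) ys = ≡.trans (length-++ (map (x ,_) ys))
  (cong₂ ℕ._+_ (length-map (x ,_) ys) (length-cartesianProduct xs ys))

HasCardinality-× : {P : Pred A p} {Q : Pred B q} →
                   HasCardinality P m → HasCardinality Q n →
                   HasCardinality (λ (x , y) → P x × Q y) (m ℕ.* n)
HasCardinality-× (xs , xs! , ∈⇔P , refl) (ys , ys! , ∈⇔Q , refl) =
  List.cartesianProduct xs ys
  , Unique.cartesianProduct⁺ xs! ys!
  , (λ (x , y) → mk⇔ (λ xy∈ → let x∈ , y∈ = ∈-cartesianProduct⁻ xs ys xy∈ in
                                ∈⇔P x .to x∈ , ∈⇔Q y .to y∈)
                     (λ (Px , Qy) → ∈-cartesianProduct⁺ (∈⇔P x .from Px) (∈⇔Q y .from Qy)))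
  , length-cartesianProduct xs ys

-- Fibres over distinct values are disjoint, so uniqueness of `ys` lets their sizes be added. It is
-- used to sort edges by their numbers of rows and columns.
HasCardinality-fibres : (f : A → B) (#fibre : B → ℕ) →
                        (∀ y → HasCardinality (λ x → f x ≡ y × P x) (#fibre y)) →
                        ∀ {ys} → Unique ys →
                        HasCardinality (λ x → f x ∈ ys × P x) (sumℕ (map #fibre ys))
HasCardinality-fibres f #fibre fibre []                = HasCardinality-∅ λ { _ (() , _) }
HasCardinality-fibres f #fibre fibre (_∷_ {x = y} y∉ys ys!) =
  HasCardinality-resp-⇔
    (HasCardinality-⊎ (fibre y) (HasCardinality-fibres f #fibre fibre ys!)
      λ { x (refl , _) (fx∈ys , _) → All.lookup y∉ys fx∈ys refl })
    (λ x → mk⇔ (λ { (inj₁ (fx≡y  , Px)) → here fx≡y , Px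
                  ; (inj₂ (fx∈ys , Px)) → there fx∈ys , Px })
               (λ { (here fx≡y   , Px) → inj₁ (fx≡y , Px)
                  ; (there fx∈ys , Px) → inj₂ (fx∈ys , Px) }))

-- Counting the subsets of given size above a given set.

HasCardinality-∷ : {P : Pred (Subset (suc n)) p} →
                   HasCardinality (P ∘ (inside ∷_)) l → HasCardinality (P ∘ (outside ∷_)) m →
                   HasCardinality P (l ℕ.+ m)
HasCardinality-∷ #in #out = HasCardinality-resp-⇔
  (HasCardinality-⊎ (HasCardinality-map (inside ∷_) ∷-injectiveʳ #in)
                    (HasCardinality-map (outside ∷_) ∷-injectiveʳ #out)
                    λ { _ (_ , _ , refl) (_ , _ , ()) })
  (λ { (true  ∷ α) → mk⇔ (λ { (inj₁ (_ , Pα , refl)) → Pα }) (λ Pα → inj₁ (α , Pα , refl))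
     ; (false ∷ α) → mk⇔ (λ { (inj₂ (_ , Pα , refl)) → Pα }) (λ Pα → inj₂ (α , Pα , refl)) })

-- The number of k-subsets containing a given set s, where m = ∣ ∁ s ∣ and a = ∣ s ∣.
#supersets : ℕ → ℕ → ℕ → ℕ
#supersets m zero    k       = m C k
#supersets m (suc a) zero    = 0
#supersets m (suc a) (suc k) = #supersets m a k

#supersets-zero : ∀ m a → #supersets (suc m) a 0 ≡ #supersets m a 0
#supersets-zero m zero    = refl
#supersets-zero m (suc a) = refl

-- Pascal's rule, applied once the `a` forced elements have been peeled off from `k`. If `k` runs
-- out first, what remains is independence of `m`, since `m C 0` is always 1.
#supersets-suc : ∀ m a k → #supersets m a k ℕ.+ #supersets m a (suc k) ≡ #supersets (suc m) a (suc k)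
#supersets-suc m zero    k       = nCk+nC[k+1]≡[n+1]C[k+1] m k
#supersets-suc m (suc a) zero    = ≡.sym (#supersets-zero m a)
#supersets-suc m (suc a) (suc k) = #supersets-suc m a k

Superset : Subset n → ℕ → Pred (Subset n) _
Superset s k α = ∣ α ∣ ≡ k × s ⊆ α

-- Induction along `s`: a first element lying in `s` is forced into the subset and lowers `k`; one
-- outside `s` may be taken or left, and the two counts add up by Pascal's rule.
supersets-cardinality : (s : Subset n) (k : ℕ) →
                        HasCardinality (Superset s k) (#supersets ∣ ∁ s ∣ ∣ s ∣ k)
supersets-cardinality [] zero =
  [] ∷ [] , [] ∷ [] , (λ { [] → mk⇔ (λ _ → refl , λ ()) (λ _ → here refl) }) , refl
supersets-cardinality [] (suc k) = HasCardinality-∅ λ { [] () }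
supersets-cardinality (true ∷ s) zero =
  HasCardinality-∅ λ { (true ∷ α) () ; (false ∷ α) (_ , s⊆α) → contradiction (s⊆α here) λ () }
supersets-cardinality (true ∷ s) (suc k) =
  -- The summand 0 removed here counts the sets that omit an element of `s`.
  subst (HasCardinality (Superset (true ∷ s) (suc k))) (ℕ.+-identityʳ _)
  (HasCardinality-∷
    (HasCardinality-resp-⇔ (supersets-cardinality s k)
      (λ _ → mk⇔ (cong suc) ℕ.suc-injective ×-⇔ in⊆in-⇔))
    (HasCardinality-∅ λ _ (_ , s⊆α) → contradiction (s⊆α here) λ ()))
supersets-cardinality (false ∷ s) zero =
  subst (HasCardinality (Superset (false ∷ s) zero)) (≡.sym (#supersets-zero _ ∣ s ∣))
  (HasCardinality-∷
    (HasCardinality-∅ λ { _ (() , _) })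
    (HasCardinality-resp-⇔ (supersets-cardinality s zero)
      (λ _ → ⇔-id _ ×-⇔ out⊆-⇔)))
supersets-cardinality (false ∷ s) (suc k) =
  subst (HasCardinality (Superset (false ∷ s) (suc k))) (#supersets-suc _ ∣ s ∣ k)
  (HasCardinality-∷
    (HasCardinality-resp-⇔ (supersets-cardinality s k)
      (λ _ → mk⇔ (cong suc) ℕ.suc-injective ×-⇔ out⊆-⇔))
    (HasCardinality-resp-⇔ (supersets-cardinality s (suc k))
      (λ _ → ⇔-id _ ×-⇔ out⊆-⇔)))

-- Sets of rows and columns as concatenations.

∣α++β∣≡∣α∣+∣β∣ : (α : Subset m) (β : Subset n) → ∣ α ++ β ∣ ≡ ∣ α ∣ ℕ.+ ∣ β ∣
∣α++β∣≡∣α∣+∣β∣ []          β = refl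
∣α++β∣≡∣α∣+∣β∣ (true  ∷ α) β = cong suc (∣α++β∣≡∣α∣+∣β∣ α β)
∣α++β∣≡∣α∣+∣β∣ (false ∷ α) β = ∣α++β∣≡∣α∣+∣β∣ α β

++-⊆⁺ : {σ α : Subset m} {τ β : Subset n} → σ ⊆ α → τ ⊆ β → σ ++ τ ⊆ α ++ β
++-⊆⁺ {σ = []}        {α = []}    σ⊆α τ⊆β x∈         = τ⊆β x∈
-- Matching on `σ⊆α here` forces `y` to be `inside`; only then does `here` inhabit the goal.
++-⊆⁺ {σ = true ∷ σ}  {α = y ∷ α} σ⊆α τ⊆β here with here ← σ⊆α here = here
++-⊆⁺ {σ = _ ∷ σ}     {α = y ∷ α} σ⊆α τ⊆β (there x∈) = there (++-⊆⁺ (drop-∷-⊆ σ⊆α) τ⊆β x∈)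

++-⊆⁻ : (σ α : Subset m) {τ β : Subset n} → σ ++ τ ⊆ α ++ β → σ ⊆ α × τ ⊆ β
++-⊆⁻ []      []      στ⊆αβ = (λ ()) , στ⊆αβ
++-⊆⁻ (_ ∷ σ) (_ ∷ α) {τ} {β} στ⊆αβ = σ⊆α , proj₂ tail
  where
  tail : σ ⊆ α × τ ⊆ β
  tail = ++-⊆⁻ σ α (drop-∷-⊆ στ⊆αβ)

  σ⊆α : _ ∷ σ ⊆ _ ∷ α
  σ⊆α here with here ← στ⊆αβ here = here
  σ⊆α (there x∈) = there (proj₁ tail x∈)

⁅x⁆⊆p⇔x∈p : {x : Fin n} {p : Subset n} → ⁅ x ⁆ ⊆ p ⇔ x ∈ₛ p
⁅x⁆⊆p⇔x∈p {x = x} {p} = mk⇔ (λ ⁅x⁆⊆p → ⁅x⁆⊆p (x∈⁅x⁆ x))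
                             (λ x∈p {_} y∈⁅x⁆ → subst (_∈ₛ p) (≡.sym (x∈⁅y⁆⇒x≡y x y∈⁅x⁆)) x∈p)

-- Edge shapes and the arithmetic of their counts.

edgeShapes : List (ℕ × ℕ)
edgeShapes = (2 , 1) ∷ (1 , 2) ∷ (3 , 1) ∷ (1 , 3) ∷ []

edgeShapes-unique : Unique edgeShapes
edgeShapes-unique =
  ((λ ()) ∷ (λ ()) ∷ (λ ()) ∷ []) ∷ ((λ ()) ∷ (λ ()) ∷ []) ∷ ((λ ()) ∷ []) ∷ [] ∷ []

-- The number of edges containing i given rows and j given columns.
#edges : ℕ → ℕ → ℕ → ℕ
#edges v i j = sumℕ (map (λ (k , l) → #supersets (v ∸ i) i k ℕ.* #supersets (v ∸ j) j l) edgeShapes)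

-- The formula n(n - 1)/2 without division or truncated subtraction; it eliminates `w C 2` in
-- `#edges-1-1`.
2*[nC2]+n≡n*n : ∀ n → 2 ℕ.* (n C 2) ℕ.+ n ≡ n ℕ.* n
2*[nC2]+n≡n*n zero    = refl
2*[nC2]+n≡n*n (suc n) = begin
  2 ℕ.* (suc n C 2) ℕ.+ suc n
    ≡⟨ cong (λ c → 2 ℕ.* c ℕ.+ suc n) (nCk+nC[k+1]≡[n+1]C[k+1] n 1) ⟨
  2 ℕ.* (n C 1 ℕ.+ n C 2) ℕ.+ suc n    ≡⟨ cong (λ c → 2 ℕ.* (c ℕ.+ n C 2) ℕ.+ suc n) (nC1≡n n) ⟩
  2 ℕ.* (n ℕ.+ n C 2) ℕ.+ suc n        ≡⟨ regroup n (n C 2) ⟩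
  (2 ℕ.* (n C 2) ℕ.+ n) ℕ.+ (2 ℕ.* n ℕ.+ 1) ≡⟨ cong (ℕ._+ (2 ℕ.* n ℕ.+ 1)) (2*[nC2]+n≡n*n n) ⟩
  n ℕ.* n ℕ.+ (2 ℕ.* n ℕ.+ 1)          ≡⟨ square n ⟩
  suc n ℕ.* suc n                      ∎
  where
  open ≡-Reasoning
  regroup : ∀ n c → 2 ℕ.* (n ℕ.+ c) ℕ.+ suc n ≡ (2 ℕ.* c ℕ.+ n) ℕ.+ (2 ℕ.* n ℕ.+ 1)
  regroup = solve-∀
  square : ∀ n → n ℕ.* n ℕ.+ (2 ℕ.* n ℕ.+ 1) ≡ suc n ℕ.* suc n
  square = solve-∀

-- `edgeShapes` is closed under exchanging coordinates, so counts for columns reduce to counts for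
-- rows.
#edges-comm : ∀ v i j → #edges v i j ≡ #edges v j i
#edges-comm v i j = swap (s i 1) (s i 2) (s i 3) (s j 1) (s j 2) (s j 3)
  where
  s : ℕ → ℕ → ℕ
  s i = #supersets (v ∸ i) i
  swap : ∀ i₁ i₂ i₃ j₁ j₂ j₃ →
    i₂ ℕ.* j₁ ℕ.+ (i₁ ℕ.* j₂ ℕ.+ (i₃ ℕ.* j₁ ℕ.+ (i₁ ℕ.* j₃ ℕ.+ 0))) ≡
    j₂ ℕ.* i₁ ℕ.+ (j₁ ℕ.* i₂ ℕ.+ (j₃ ℕ.* i₁ ℕ.+ (j₁ ℕ.* i₃ ℕ.+ 0)))
  swap = solve-∀

-- Moves `v` to the other side, so that no truncated subtraction is left in the goals given to the
-- ring solver.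
+≡²⇒≡²∸ : ∀ {m v} → m ℕ.+ v ≡ v ℕ.* v → m ≡ v ℕ.^ 2 ∸ v
+≡²⇒≡²∸ {m} {v} m+v≡v² = begin
  m                     ≡⟨ ℕ.m+n∸n≡m m v ⟨
  m ℕ.+ v ∸ v           ≡⟨ cong (_∸ v) m+v≡v² ⟩
  v ℕ.* v ∸ v           ≡⟨ cong (λ w → v ℕ.* w ∸ v) (ℕ.*-identityʳ v) ⟨
  v ℕ.^ 2 ∸ v           ∎
  where open ≡-Reasoning

-- Two rows extend to an edge by one of `v` columns, or by one of v - 2 further rows together with a
-- column: v + (v - 2)v = v² - v. The bound matters: at `v` = 1 the truncated formula would count 1
-- instead of 0.
#edges-2-0 : ∀ {v} → 2 ≤ v → #edges v 2 0 ≡ v ℕ.^ 2 ∸ v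
#edges-2-0 {suc (suc u)} (s≤s (s≤s _)) rewrite nC1≡n (2 ℕ.+ u) | nC1≡n u = +≡²⇒≡²∸ (expand u)
  where
  expand : ∀ u → 1 ℕ.* (2 ℕ.+ u) ℕ.+ (0 ℕ.+ (u ℕ.* (2 ℕ.+ u) ℕ.+ (0 ℕ.+ 0))) ℕ.+ (2 ℕ.+ u)
                 ≡ (2 ℕ.+ u) ℕ.* (2 ℕ.+ u)
  expand = solve-∀

-- With w = v - 1, a row and a column extend by one further row or column in 2w ways, or by two
-- further rows or two further columns in 2(w C 2) = w² - w ways. The total w² + w is again v² - v.
#edges-1-1 : ∀ {v} → 1 ≤ v → #edges v 1 1 ≡ v ℕ.^ 2 ∸ v
#edges-1-1 {suc w} (s≤s _) rewrite nC1≡n w = +≡²⇒≡²∸ (begin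
  w ℕ.* 1 ℕ.+ (1 ℕ.* w ℕ.+ (c ℕ.* 1 ℕ.+ (1 ℕ.* c ℕ.+ 0))) ℕ.+ (1 ℕ.+ w) ≡⟨ collect w c ⟩
  (2 ℕ.* c ℕ.+ w) ℕ.+ (2 ℕ.* w ℕ.+ 1)   ≡⟨ cong (ℕ._+ (2 ℕ.* w ℕ.+ 1)) (2*[nC2]+n≡n*n w) ⟩
  w ℕ.* w ℕ.+ (2 ℕ.* w ℕ.+ 1)           ≡⟨ square w ⟩
  (1 ℕ.+ w) ℕ.* (1 ℕ.+ w)               ∎)
  where
  open ≡-Reasoning
  c = w C 2
  collect : ∀ w c → w ℕ.* 1 ℕ.+ (1 ℕ.* w ℕ.+ (c ℕ.* 1 ℕ.+ (1 ℕ.* c ℕ.+ 0))) ℕ.+ (1 ℕ.+ w)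
                    ≡ (2 ℕ.* c ℕ.+ w) ℕ.+ (2 ℕ.* w ℕ.+ 1)
  collect = solve-∀
  square : ∀ w → w ℕ.* w ℕ.+ (2 ℕ.* w ℕ.+ 1) ≡ (1 ℕ.+ w) ℕ.* (1 ℕ.+ w)
  square = solve-∀

#edges-pair : ∀ {v} i j → i ≤ v → j ≤ v → i ℕ.+ j ≡ 2 → #edges v i j ≡ v ℕ.^ 2 ∸ v
#edges-pair {v} 0 2 _   2≤v refl = ≡.trans (#edges-comm v 0 2) (#edges-2-0 2≤v)
#edges-pair     1 1 1≤v _   refl = #edges-1-1 1≤v
#edges-pair     2 0 2≤v _   refl = #edges-2-0 2≤v

-- Regularity asks only for some common degree, so `#edges v 1 0` stays unevaluated.
#edges-point : ∀ v i j → i ℕ.+ j ≡ 1 → #edges v i j ≡ #edges v 1 0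
#edges-point v 0 1 refl = #edges-comm v 0 1
#edges-point v 1 0 refl = refl

-- Hypergraphs whose edges are determined by their shape.

module _ {v} (E : Hypergraph (v ℕ.+ v) p)
         (E⇔edgeShape : ∀ (α β : Subset v) → E (α ++ β) ⇔ (∣ α ∣ , ∣ β ∣) ∈ edgeShapes) where

  -- For a fixed shape the rows above `σ` and the columns above `τ` are chosen independently, which
  -- gives a product; summing over the shapes gives `#edges`. Injectivity of `_++_` ensures that
  -- each edge is counted once.
  edges⊇-cardinality : (σ τ : Subset v) →
    HasCardinality (λ e → E e × σ ++ τ ⊆ e) (#edges v ∣ σ ∣ ∣ τ ∣)
  edges⊇-cardinality σ τ = HasCardinality-resp-⇔
    (HasCardinality-map (uncurry _++_) (λ {x} {y} → ×-≡,≡→≡ ∘ ++-injective (proj₁ x) (proj₁ y))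
      (HasCardinality-fibres {P = λ (α , β) → σ ++ τ ⊆ α ++ β} (λ (α , β) → ∣ α ∣ , ∣ β ∣) _
        (λ (k , l) → HasCardinality-resp-⇔ (HasCardinality-× (fixed σ k) (fixed τ l))
          (λ (α , β) → mk⇔ glue (split α)))
        edgeShapes-unique))
    (λ e → mk⇔
      (λ { ((α , β) , shape,⊆ , refl) → map₁ (E⇔edgeShape α β .from) shape,⊆ })
      (λ E,⊆ → let α , β , e≡αβ = Vec.splitAt v e in
        (α , β)
        , map₁ (E⇔edgeShape α β .to) (subst (λ e → E e × σ ++ τ ⊆ e) e≡αβ E,⊆)
        , e≡αβ))
    where
    glue : ∀ {α β k l} → Superset σ k α × Superset τ l β →
           (∣ α ∣ , ∣ β ∣) ≡ (k , l) × σ ++ τ ⊆ α ++ β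
    glue ((refl , σ⊆α) , (refl , τ⊆β)) = refl , ++-⊆⁺ σ⊆α τ⊆β

    split : ∀ α {β k l} → (∣ α ∣ , ∣ β ∣) ≡ (k , l) × σ ++ τ ⊆ α ++ β →
            Superset σ k α × Superset τ l β
    split α (refl , στ⊆αβ) with σ⊆α , τ⊆β ← ++-⊆⁻ σ α στ⊆αβ = (refl , σ⊆α) , (refl , τ⊆β)

    fixed : (s : Subset v) (k : ℕ) →
            HasCardinality (Superset s k) (#supersets (v ∸ ∣ s ∣) ∣ s ∣ k)
    fixed s k = subst (λ m → HasCardinality (Superset s k) (#supersets m ∣ s ∣ k)) (∣∁p∣≡n∸∣p∣ s)
                      (supersets-cardinality s k)

  balanced : (s : Subset (v ℕ.+ v)) → ∣ s ∣ ≡ 2 → HasCardinality (λ e → E e × s ⊆ e) (v ℕ.^ 2 ∸ v)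
  balanced s ∣s∣≡2 with σ , τ , refl ← Vec.splitAt v s =
    subst (HasCardinality _)
          (#edges-pair ∣ σ ∣ ∣ τ ∣ (∣p∣≤n σ) (∣p∣≤n τ) (≡.trans (≡.sym (∣α++β∣≡∣α∣+∣β∣ σ τ)) ∣s∣≡2))
          (edges⊇-cardinality σ τ)

  regular : IsRegular E
  regular = #edges v 1 0 , λ x → HasCardinality-resp-⇔ (through ⁅ x ⁆ (∣⁅x⁆∣≡1 x))
    (λ _ → ⇔-id _ ×-⇔ ⁅x⁆⊆p⇔x∈p)
    where
    through : (s : Subset (v ℕ.+ v)) → ∣ s ∣ ≡ 1 →
              HasCardinality (λ e → E e × s ⊆ e) (#edges v 1 0)
    through s ∣s∣≡1 with σ , τ , refl ← Vec.splitAt v s =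
      subst (HasCardinality _)
            (#edges-point v ∣ σ ∣ ∣ τ ∣ (≡.trans (≡.sym (∣α++β∣≡∣α∣+∣β∣ σ τ)) ∣s∣≡1))
            (edges⊇-cardinality σ τ)

-- The canonical homomorphism from the integers to a ring.

module FromInteger {c ℓ} (R : Ring c ℓ) where
  open Ring R renaming (refl to ≈-refl)
  open RingProperties R
  open Mult semiring using (×-homo-+; ×-homo-1; ×1-homo-*) renaming (_×_ to _×ᴿ_)
  open SetoidReasoning setoid

  fromℤ : ℤ → Carrier
  fromℤ (+ n)    = n ×ᴿ 1#
  fromℤ -[1+ n ] = - (suc n ×ᴿ 1#)

  -- Integer addition with opposite signs is defined through `⊖`, so this settles the mixed cases of
  -- additivity. The successor step inserts 1 - 1 between the two multiples.
  fromℤ-⊖ : ∀ m n → fromℤ (m ⊖ n) ≈ m ×ᴿ 1# - n ×ᴿ 1#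
  fromℤ-⊖ m zero = sym (trans (+-congˡ -0#≈0#) (+-identityʳ _))
  fromℤ-⊖ zero (suc n) = sym (+-identityˡ _)
  fromℤ-⊖ (suc m) (suc n) = begin
    fromℤ (suc m ⊖ suc n)                 ≡⟨ cong fromℤ (ℤ.[1+m]⊖[1+n]≡m⊖n m n) ⟩
    fromℤ (m ⊖ n)                         ≈⟨ fromℤ-⊖ m n ⟩
    m ×ᴿ 1# - n ×ᴿ 1#                       ≈⟨ +-congʳ (+-identityʳ _) ⟨
    m ×ᴿ 1# + 0# - n ×ᴿ 1#                  ≈⟨ +-congʳ (+-congˡ (-‿inverseʳ 1#)) ⟨
    m ×ᴿ 1# + (1# - 1#) - n ×ᴿ 1#           ≈⟨ +-congʳ (+-assoc _ _ _) ⟨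
    m ×ᴿ 1# + 1# - 1# - n ×ᴿ 1#             ≈⟨ +-congʳ (+-congʳ (+-comm _ _)) ⟩
    suc m ×ᴿ 1# - 1# - n ×ᴿ 1#              ≈⟨ +-assoc _ _ _ ⟩
    suc m ×ᴿ 1# + (- 1# - n ×ᴿ 1#)          ≈⟨ +-congˡ (-‿+-comm _ _) ⟩
    suc m ×ᴿ 1# - suc n ×ᴿ 1#               ∎

  fromℤ-homo-+ : ∀ i j → fromℤ (i ℤ.+ j) ≈ fromℤ i + fromℤ j
  fromℤ-homo-+ (+ m)    (+ n)    = ×-homo-+ 1# m n
  fromℤ-homo-+ (+ m)    -[1+ n ] = fromℤ-⊖ m (suc n)
  fromℤ-homo-+ -[1+ m ] (+ n)    = trans (fromℤ-⊖ n (suc m)) (+-comm _ _)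
  fromℤ-homo-+ -[1+ m ] -[1+ n ] = begin
    - (suc (suc (m ℕ.+ n)) ×ᴿ 1#)          ≡⟨ cong (λ k → - (suc k ×ᴿ 1#)) (ℕ.+-suc m n) ⟨
    - ((suc m ℕ.+ suc n) ×ᴿ 1#)            ≈⟨ -‿cong (×-homo-+ 1# (suc m) (suc n)) ⟩
    - (suc m ×ᴿ 1# + suc n ×ᴿ 1#)           ≈⟨ -‿+-comm _ _ ⟨
    - (suc m ×ᴿ 1#) - suc n ×ᴿ 1#           ∎

  fromℤ-homo-neg : ∀ i → fromℤ (ℤ.- i) ≈ - fromℤ i
  fromℤ-homo-neg (+ zero)  = sym -0#≈0#
  fromℤ-homo-neg (+ suc n) = ≈-refl
  fromℤ-homo-neg -[1+ n ]  = sym (-‿involutive _)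

  fromℤ-homo-1 : fromℤ 1ℤ ≈ 1#
  fromℤ-homo-1 = ×-homo-1 1#

  -- A non-negative left factor comes first: there the claim is multiplicativity of natural
  -- multiples up to one sign. A negative left factor then has its sign pulled out in front.
  fromℤ-homo-*⁺ : ∀ m j → fromℤ (+ m ℤ.* j) ≈ fromℤ (+ m) * fromℤ j
  fromℤ-homo-*⁺ m (+ n) = begin
    fromℤ (+ m ℤ.* + n)                   ≡⟨ cong fromℤ (ℤ.pos-* m n) ⟨
    (m ℕ.* n) ×ᴿ 1#                        ≈⟨ ×1-homo-* m n ⟩
    (m ×ᴿ 1#) * (n ×ᴿ 1#)                   ∎
  fromℤ-homo-*⁺ m -[1+ n ] = begin
    fromℤ (+ m ℤ.* -[1+ n ])              ≡⟨ cong fromℤ (ℤ.neg-distribʳ-* (+ m) (+ suc n)) ⟨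
    fromℤ (ℤ.- (+ m ℤ.* + suc n))         ≈⟨ fromℤ-homo-neg (+ m ℤ.* + suc n) ⟩
    - fromℤ (+ m ℤ.* + suc n)             ≈⟨ -‿cong (fromℤ-homo-*⁺ m (+ suc n)) ⟩
    - (fromℤ (+ m) * (suc n ×ᴿ 1#))        ≈⟨ -‿distribʳ-* _ _ ⟩
    fromℤ (+ m) * fromℤ -[1+ n ]          ∎
  fromℤ-homo-* : ∀ i j → fromℤ (i ℤ.* j) ≈ fromℤ i * fromℤ j
  fromℤ-homo-* (+ m)    j = fromℤ-homo-*⁺ m j
  fromℤ-homo-* -[1+ m ] j = begin
    fromℤ (-[1+ m ] ℤ.* j)                ≡⟨ cong fromℤ (ℤ.neg-distribˡ-* (+ suc m) j) ⟨
    fromℤ (ℤ.- (+ suc m ℤ.* j))           ≈⟨ fromℤ-homo-neg (+ suc m ℤ.* j) ⟩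
    - fromℤ (+ suc m ℤ.* j)               ≈⟨ -‿cong (fromℤ-homo-*⁺ (suc m) j) ⟩
    - ((suc m ×ᴿ 1#) * fromℤ j)            ≈⟨ -‿distribˡ-* _ _ ⟩
    fromℤ -[1+ m ] * fromℤ j              ∎

-- Characteristic zero and the square roots of 1.

module RealProperties {c ℓ₁ ℓ₂} (R : RealNumbers c ℓ₁ ℓ₂) where
  open RealNumbers R renaming (refl to ≈-refl)
  open CommutativeRing commutativeRing public using (ring)
  open IsStrictPartialOrder isStrictPartialOrder using (irrefl; <-respˡ-≈; <-respʳ-≈)
    renaming (trans to <-trans)
  open HeytingProperties heytingCommutativeRing using (1#0)
  open RingProperties ring
  open FromInteger ring public
  open SetoidReasoning setoid

  +-monoˡ-<′ : ∀ {x y} z → x < y → z + x < z + y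
  +-monoˡ-<′ z x<y = <-respˡ-≈ (+-comm _ z) (<-respʳ-≈ (+-comm _ z) (+-monoˡ-< z x<y))

  -1*-1≈1 : - 1# * - 1# ≈ 1#
  -1*-1≈1 = trans (-1*x≈-x (- 1#)) (-‿involutive 1#)

  -- Apartness alone says that 1 lies on one side of 0. Were 1 < 0, then 0 < -1, and (-1)(-1) = 1
  -- would be positive as a product of positives.
  0<1 : 0# < 1#
  0<1 with #⇔<⊎> 1# 0# .to 1#0
  ... | inj₂ 0<1 = 0<1
  ... | inj₁ 1<0 = <-respʳ-≈ -1*-1≈1 (*-pos 0<-1 0<-1)
    where
    0<-1 : 0# < - 1#
    0<-1 = <-respˡ-≈ (-‿inverseʳ 1#) (<-respʳ-≈ (+-identityˡ _) (+-monoˡ-< (- 1#) 1<0))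

  0<fromℤ[1+n] : ∀ n → 0# < fromℤ (+ suc n)
  0<fromℤ[1+n] zero    = <-respʳ-≈ (sym fromℤ-homo-1) 0<1
  0<fromℤ[1+n] (suc n) = <-trans 0<1
    (<-respˡ-≈ (+-identityʳ 1#) (+-monoˡ-<′ 1# (0<fromℤ[1+n] n)))

  -- Positive multiples of 1 are positive, hence differ from 0 by irreflexivity. This makes `fromℤ`
  -- injective, so that determinants can be read back as integers.
  fromℤ≈0⇒≡0 : ∀ i → fromℤ i ≈ 0# → i ≡ 0ℤ
  fromℤ≈0⇒≡0 (+ zero)  _   = ≡.refl
  fromℤ≈0⇒≡0 (+ suc n) i≈0 = contradiction (0<fromℤ[1+n] n) (irrefl (sym i≈0))
  fromℤ≈0⇒≡0 -[1+ n ]  i≈0 = contradiction (0<fromℤ[1+n] n) (irrefl (begin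
    0#                   ≈⟨ -0#≈0# ⟨
    - 0#                 ≈⟨ -‿cong i≈0 ⟨
    - fromℤ -[1+ n ]     ≈⟨ -‿involutive _ ⟩
    fromℤ (+ suc n)      ∎))

  fromℤ-injective : ∀ i j → fromℤ i ≈ fromℤ j → i ≡ j
  fromℤ-injective i j i≈j = ℤ.i-j≡0⇒i≡j i j (fromℤ≈0⇒≡0 (i ℤ.- j) (begin
    fromℤ (i ℤ.- j)             ≈⟨ fromℤ-homo-+ i (ℤ.- j) ⟩
    fromℤ i + fromℤ (ℤ.- j)     ≈⟨ +-cong i≈j (fromℤ-homo-neg j) ⟩
    fromℤ j - fromℤ j           ≈⟨ -‿inverseʳ _ ⟩
    0#                          ∎))

  1#-1 : 1# # - 1#
  1#-1 = #⇔<⊎> 1# (- 1#) .from (inj₂ (<-trans -1<0 0<1))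
    where
    -1<0 : - 1# < 0#
    -1<0 = <-respˡ-≈ (+-identityˡ _) (<-respʳ-≈ (-‿inverseʳ 1#) (+-monoˡ-< (- 1#) 0<1))

  -- Apartness provides an inverse of `x - y`, with which the factor is cancelled.
  x#y∧[x-y]z≈0⇒z≈0 : ∀ {x y z} → x # y → (x - y) * z ≈ 0# → z ≈ 0#
  x#y∧[x-y]z≈0⇒z≈0 {x} {y} {z} x#y [x-y]z≈0 = let d , d[x-y]≈1 , _ = #⇒invertible x#y in begin
    z                    ≈⟨ *-identityˡ z ⟨
    1# * z               ≈⟨ *-congʳ d[x-y]≈1 ⟨
    d * (x - y) * z      ≈⟨ *-assoc _ _ _ ⟩
    d * ((x - y) * z)    ≈⟨ *-congˡ [x-y]z≈0 ⟩
    d * 0#               ≈⟨ zeroʳ d ⟩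
    0#                   ∎

  -- Factor x² - y² = (x - y)(x + y) and cancel the invertible factor.
  x²≈y²∧x#y⇒x≈-y : ∀ {x y} → x * x ≈ y * y → x # y → x ≈ - y
  x²≈y²∧x#y⇒x≈-y {x} {y} x²≈y² x#y = +-inverseˡ-unique x y (x#y∧[x-y]z≈0⇒z≈0 x#y (begin
    (x - y) * (x + y)                  ≈⟨ [y-z]x≈yx-zx _ _ _ ⟩
    x * (x + y) - y * (x + y)          ≈⟨ +-congʳ (distribˡ _ _ _) ⟩
    x * x + x * y - y * (x + y)        ≈⟨ +-congʳ (+-cong x²≈y² (*-comm _ _)) ⟩
    y * y + y * x - y * (x + y)        ≈⟨ +-congʳ (distribˡ _ _ _) ⟨
    y * (y + x) - y * (x + y)          ≈⟨ +-congʳ (*-congˡ (+-comm _ _)) ⟩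
    y * (x + y) - y * (x + y)          ≈⟨ -‿inverseʳ _ ⟩
    0#                                 ∎))

  -- Equality with ±1 is not decidable a priori: cotransitivity of 1 # -1 selects the sign.
  x²≈1⇒x≈±1 : ∀ {x} → x * x ≈ 1# → ∃[ s ] x ≈ fromℤ (s ◃ 1)
  x²≈1⇒x≈±1 {x} x²≈1 with #-cotrans 1#-1 x
  ... | inj₁ 1#x  = Sign.- , trans
    (x²≈y²∧x#y⇒x≈-y (trans x²≈1 (sym (*-identityˡ 1#))) (#-sym 1#x))
    (-‿cong (sym fromℤ-homo-1))
  ... | inj₂ x#-1 = Sign.+ , trans
    (x²≈y²∧x#y⇒x≈-y (trans x²≈1 (sym -1*-1≈1)) x#-1)
    (trans (-‿involutive 1#) (sym fromℤ-homo-1))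

-- Integer determinants of bordered sign matrices.

open RawSemiringDefs ℤ.+-*-rawSemiring using () renaming (sum to sumℤ; _^_ to _^ℤ_)

IntegerMatrix : ℕ → Set
IntegerMatrix n = Fin n → Fin n → ℤ

-- The expansion copies `det` term by term, so one induction transfers it to ℂ, while over ℤ it
-- evaluates to numerals and small cases hold by computation.
detℤ : IntegerMatrix n → ℤ
detℤ {zero}  P = 1ℤ
detℤ {suc n} P = sumℤ λ j →
  -1ℤ ^ℤ Fin.toℕ j ℤ.* (P Fin.zero j ℤ.* detℤ (λ k l → P (Fin.suc k) (punchIn j l)))

SignMatrix : ℕ → ℕ → Set
SignMatrix m n = Fin m → Fin n → Sign

entry : SignMatrix m n → Fin m ⊎ Fin n → Fin m ⊎ Fin n → ℤ
entry S (inj₁ i) (inj₁ j) = if does (i ≟ j) then 1ℤ else 0ℤ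
entry S (inj₁ i) (inj₂ j) = S i j ◃ 1
entry S (inj₂ i) (inj₁ j) = S j i ◃ 1
entry S (inj₂ i) (inj₂ j) = if does (i ≟ j) then 1ℤ else 0ℤ

-- The analogue of `A` for a possibly rectangular block, since a principal submatrix may keep
-- different numbers of rows and columns.
bordered : SignMatrix m n → IntegerMatrix (m ℕ.+ n)
bordered {m} S i j = entry S (Fin.splitAt m i) (Fin.splitAt m j)

-- The integers inside the complex numbers.

module ComplexProperties {c ℓ₁ ℓ₂} (R : RealNumbers c ℓ₁ ℓ₂) where
  private module ℝ = RealNumbers R
  open RealProperties R using (ring; fromℤ; fromℤ-homo-+; fromℤ-homo-*; fromℤ-homo-neg; fromℤ-homo-1;
                               fromℤ-injective; x²≈1⇒x≈±1)
  open RingProperties ring using (-0#≈0#)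
  open ComplexMatrices R

  ≈-refl : ∀ {z} → z ≈ z
  ≈-refl = ℝ.refl , ℝ.refl

  ≈-sym : ∀ {z w} → z ≈ w → w ≈ z
  ≈-sym (re≈ , im≈) = ℝ.sym re≈ , ℝ.sym im≈

  ≈-trans : ∀ {x y z} → x ≈ y → y ≈ z → x ≈ z
  ≈-trans (re≈ , im≈) (re≈′ , im≈′) = ℝ.trans re≈ re≈′ , ℝ.trans im≈ im≈′

  +-cong : ∀ {x y u v} → x ≈ y → u ≈ v → x + u ≈ y + v
  +-cong (re≈ , im≈) (re≈′ , im≈′) = ℝ.+-cong re≈ re≈′ , ℝ.+-cong im≈ im≈′

  -‿cong : ∀ {x y} → x ≈ y → - x ≈ - y
  -‿cong (re≈ , im≈) = ℝ.-‿cong re≈ , ℝ.-‿cong im≈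

  *-cong : ∀ {x y u v} → x ≈ y → u ≈ v → x * u ≈ y * v
  *-cong (re≈ , im≈) (re≈′ , im≈′) =
    ℝ.+-cong (ℝ.*-cong re≈ re≈′) (ℝ.-‿cong (ℝ.*-cong im≈ im≈′)) ,
    ℝ.+-cong (ℝ.*-cong re≈ im≈′) (ℝ.*-cong im≈ re≈′)

  embed : ℤ → ℂ
  embed i = fromℤ i +i ℝ.0#

  embed-homo-0 : 0# ≈ embed 0ℤ
  embed-homo-0 = ≈-refl

  embed-homo-1 : 1# ≈ embed 1ℤ
  embed-homo-1 = ℝ.sym fromℤ-homo-1 , ℝ.refl

  embed-homo-+ : ∀ i j → embed i + embed j ≈ embed (i ℤ.+ j)
  embed-homo-+ i j = ℝ.sym (fromℤ-homo-+ i j) , ℝ.+-identityʳ ℝ.0#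

  embed-homo-neg : ∀ i → - embed i ≈ embed (ℤ.- i)
  embed-homo-neg i = ℝ.sym (fromℤ-homo-neg i) , -0#≈0#

  embed-homo-* : ∀ i j → embed i * embed j ≈ embed (i ℤ.* j)
  embed-homo-* i j =
    ℝ.trans (ℝ.+-congˡ (ℝ.trans (ℝ.-‿cong (ℝ.zeroˡ ℝ.0#)) -0#≈0#))
            (ℝ.trans (ℝ.+-identityʳ _) (ℝ.sym (fromℤ-homo-* i j))) ,
    ℝ.trans (ℝ.+-cong (ℝ.zeroʳ _) (ℝ.zeroˡ _)) (ℝ.+-identityʳ ℝ.0#)

  embed-injective : ∀ {i j} → embed i ≈ embed j → i ≡ j
  embed-injective (re≈ , _) = fromℤ-injective _ _ re≈

  embed-homo-sum : {f : Fin n → ℂ} {g : Fin n → ℤ} →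
                   (∀ i → f i ≈ embed (g i)) → sum f ≈ embed (sumℤ g)
  embed-homo-sum {zero}  f≈g = embed-homo-0
  embed-homo-sum {suc n} {g = g} f≈g =
    ≈-trans (+-cong (f≈g Fin.zero) (embed-homo-sum (f≈g ∘ Fin.suc)))
            (embed-homo-+ (g Fin.zero) (sumℤ (g ∘ Fin.suc)))

  embed-homo-^ : ∀ {z i} → z ≈ embed i → ∀ k → z ^ k ≈ embed (i ^ℤ k)
  embed-homo-^ z≈i zero    = embed-homo-1
  embed-homo-^ {i = i} z≈i (suc k) =
    ≈-trans (*-cong z≈i (embed-homo-^ z≈i k)) (embed-homo-* i (i ^ℤ k))

  -1≈embed : - 1# ≈ embed -1ℤ
  -1≈embed = ≈-trans (-‿cong embed-homo-1) (embed-homo-neg 1ℤ)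

  ι≈embed : ∀ k → ι k ≈ embed (+ k)
  ι≈embed zero    = embed-homo-0
  ι≈embed (suc k) = ≈-trans (+-cong embed-homo-1 (ι≈embed k)) (embed-homo-+ 1ℤ (+ k))

  -ι≈embed : ∀ k → - ι k ≈ embed (ℤ.- + k)
  -ι≈embed k = ≈-trans (-‿cong (ι≈embed k)) (embed-homo-neg (+ k))

  det≈embed : (P : Matrix n n) (Q : IntegerMatrix n) → (∀ i j → P i j ≈ embed (Q i j)) →
              det P ≈ embed (detℤ Q)
  det≈embed {zero}  P Q P≈Q = embed-homo-1
  det≈embed {suc n} P Q P≈Q = embed-homo-sum
    {g = λ j → -1ℤ ^ℤ Fin.toℕ j ℤ.* (Q Fin.zero j ℤ.* detℤ (minor j))} λ j →
    ≈-trans (*-cong (embed-homo-^ -1≈embed (Fin.toℕ j))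
                    (≈-trans (*-cong (P≈Q Fin.zero j)
                                     (det≈embed _ (minor j) λ k l → P≈Q (Fin.suc k) (punchIn j l)))
                             (embed-homo-* (Q Fin.zero j) (detℤ (minor j)))))
            (embed-homo-* (-1ℤ ^ℤ Fin.toℕ j) (Q Fin.zero j ℤ.* detℤ (minor j)))
    where
    minor : Fin (suc n) → IntegerMatrix n
    minor j k l = Q (Fin.suc k) (punchIn j l)

  -- `∣ α ++ β ∣` and `∣ α ∣ + ∣ β ∣` agree only propositionally; casting the indices avoids
  -- transporting a whole matrix.
  det≈embed-cast : (m≡n : m ≡ n) (P : Matrix m m) (Q : IntegerMatrix n) →
                   (∀ i j → P i j ≈ embed (Q (cast m≡n i) (cast m≡n j))) →
                   det P ≈ embed (detℤ Q)
  det≈embed-cast refl P Q P≈Q = det≈embed P Q λ i j →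
    ≡.subst₂ (λ i′ j′ → P i j ≈ embed (Q i′ j′)) (cast-is-id refl i) (cast-is-id refl j) (P≈Q i j)

  I≈embed : (i j : Fin n) → I i j ≈ embed (if does (i ≟ j) then 1ℤ else 0ℤ)
  I≈embed i j with does (i ≟ j)
  ... | true  = embed-homo-1
  ... | false = embed-homo-0

  entry≈embed : (H : Matrix m n) (S : SignMatrix m n) → (∀ i j → H i j ≈ embed (S i j ◃ 1)) →
                ∀ i j → ⟦ I , H ∣ H ᵀ , I ⟧ i j ≈ embed (bordered S i j)
  entry≈embed {m} H S H≈S i j with Fin.splitAt m i
  entry≈embed {m} H S H≈S i j | inj₁ x with Fin.splitAt m j
  ... | inj₁ y = I≈embed x y
  ... | inj₂ y = H≈S x y
  entry≈embed {m} H S H≈S i j | inj₂ x with Fin.splitAt m j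
  ... | inj₁ y = H≈S y x
  ... | inj₂ y = I≈embed x y

  -- With zero imaginary part, |z|² = 1 says that the real part squares to 1, which leaves the two
  -- signs.
  unimodular∧real⇒±1 : ∀ {z} → ∣ z ∣≈ ℝ.1# → im z ℝ.≈ ℝ.0# → ∃[ s ] z ≈ embed (s ◃ 1)
  unimodular∧real⇒±1 {z} (_ , 1²≈∣z∣²) im≈0 =
    let s , re≈s = x²≈1⇒x≈±1 re²≈1 in s , re≈s , im≈0
    where
    open SetoidReasoning (Ring.setoid ring)
    re²≈1 : re z ℝ.* re z ℝ.≈ ℝ.1#
    re²≈1 = begin
      re z ℝ.* re z                        ≈⟨ ℝ.+-identityʳ _ ⟨
      re z ℝ.* re z ℝ.+ ℝ.0#               ≈⟨ ℝ.+-congˡ (ℝ.zeroˡ _) ⟨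
      re z ℝ.* re z ℝ.+ ℝ.0# ℝ.* im z      ≈⟨ ℝ.+-congˡ (ℝ.*-congʳ im≈0) ⟨
      re z ℝ.* re z ℝ.+ im z ℝ.* im z      ≈⟨ 1²≈∣z∣² ⟨
      ℝ.1# ℝ.* ℝ.1#                        ≈⟨ ℝ.*-identityˡ _ ⟩
      ℝ.1#                                 ∎

-- Principal submatrices of bordered matrices.

elements-injective : (α : Subset n) {i j : Fin ∣ α ∣} → elements α i ≡ elements α j → i ≡ j
elements-injective (true  ∷ α) {Fin.zero}  {Fin.zero}  eq = refl
elements-injective (true  ∷ α) {Fin.suc i} {Fin.suc j} eq =
  cong Fin.suc (elements-injective α (suc-injective eq))
elements-injective (false ∷ α) eq = elements-injective α (suc-injective eq)

-- `elements` lists `α` before `β`, so a position belongs to the row block exactly when it lies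
-- below `∣ α ∣`.
splitAt-elements : (α : Subset m) (β : Subset n) (i : Fin ∣ α ++ β ∣) →
  Fin.splitAt m (elements (α ++ β) i) ≡
  Sum.map (elements α) (elements β) (Fin.splitAt ∣ α ∣ (cast (∣α++β∣≡∣α∣+∣β∣ α β) i))
splitAt-elements []          β i           = cong (inj₂ ∘ elements β) (≡.sym (cast-is-id refl i))
splitAt-elements (true  ∷ α) β Fin.zero    = refl
splitAt-elements (true  ∷ α) β (Fin.suc i)
  rewrite splitAt-elements α β i with Fin.splitAt ∣ α ∣ (cast (∣α++β∣≡∣α∣+∣β∣ α β) i)
... | inj₁ _ = refl
... | inj₂ _ = refl
splitAt-elements (false ∷ α) β i
  rewrite splitAt-elements α β i with Fin.splitAt ∣ α ∣ (cast (∣α++β∣≡∣α∣+∣β∣ α β) i)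
... | inj₁ _ = refl
... | inj₂ _ = refl

-- By injectivity of `elements`; it makes identity blocks restrict to identity blocks.
does-elements-≟ : (α : Subset n) (i j : Fin ∣ α ∣) →
                  does (elements α i ≟ elements α j) ≡ does (i ≟ j)
does-elements-≟ α i j with i ≟ j
... | yes i≡j = dec-true (elements α i ≟ elements α j) (cong (elements α) i≡j)
... | no  i≢j = dec-false (elements α i ≟ elements α j) (i≢j ∘ elements-injective α)

restrict : SignMatrix m n → (α : Subset m) (β : Subset n) → SignMatrix ∣ α ∣ ∣ β ∣
restrict S α β i j = S (elements α i) (elements β j)

entry-elements : (S : SignMatrix m n) (α : Subset m) (β : Subset n) → ∀ x y →
                 entry S (Sum.map (elements α) (elements β) x) (Sum.map (elements α) (elements β) y)
                 ≡ entry (restrict S α β) x y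
entry-elements S α β (inj₁ i) (inj₁ j) = cong (if_then 1ℤ else 0ℤ) (does-elements-≟ α i j)
entry-elements S α β (inj₁ i) (inj₂ j) = refl
entry-elements S α β (inj₂ i) (inj₁ j) = refl
entry-elements S α β (inj₂ i) (inj₂ j) = cong (if_then 1ℤ else 0ℤ) (does-elements-≟ β i j)

bordered-elements : (S : SignMatrix m n) (α : Subset m) (β : Subset n) →
  let ∣αβ∣≡ = ∣α++β∣≡∣α∣+∣β∣ α β in ∀ i j →
  bordered S (elements (α ++ β) i) (elements (α ++ β) j) ≡
  bordered (restrict S α β) (cast ∣αβ∣≡ i) (cast ∣αβ∣≡ j)
bordered-elements S α β i j = ≡.trans
  (cong₂ (entry S) (splitAt-elements α β i) (splitAt-elements α β j))
  (entry-elements S α β (Fin.splitAt ∣ α ∣ _) (Fin.splitAt ∣ α ∣ _))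

-- Determinants of orders three and four.

det≡-1⇒edgeShape : ∀ a b (S : SignMatrix a b) → a ℕ.+ b ≡ 3 → detℤ (bordered S) ≡ -1ℤ →
                   (a , b) ∈ edgeShapes
-- With indices from one side only the matrix is the identity, whose determinant 1 refutes the
-- equation.
det≡-1⇒edgeShape 0 3 S refl ()
det≡-1⇒edgeShape 1 2 S refl _ = there (here refl)
det≡-1⇒edgeShape 2 1 S refl _ = here refl
det≡-1⇒edgeShape 3 0 S refl ()

det≡-2⇒edgeShape : ∀ a b (S : SignMatrix a b) → a ℕ.+ b ≡ 4 → detℤ (bordered S) ≡ ℤ.- + 2 →
                   (a , b) ∈ edgeShapes
det≡-2⇒edgeShape 0 4 S refl ()
det≡-2⇒edgeShape 1 3 S refl _ = there (there (there (here refl)))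
-- The determinant is that of I - MᵀM, with diagonal entries -1 and off-diagonal entries 0 or ±2,
-- hence 1 or -3; each sign pattern is evaluated.
det≡-2⇒edgeShape 2 2 S refl det≡-2 with S 0F 0F | S 0F 1F | S 1F 0F | S 1F 1F
... | Sign.+ | Sign.+ | Sign.+ | Sign.+ = contradiction det≡-2 λ ()
... | Sign.+ | Sign.+ | Sign.+ | Sign.- = contradiction det≡-2 λ ()
... | Sign.+ | Sign.+ | Sign.- | Sign.+ = contradiction det≡-2 λ ()
... | Sign.+ | Sign.+ | Sign.- | Sign.- = contradiction det≡-2 λ ()
... | Sign.+ | Sign.- | Sign.+ | Sign.+ = contradiction det≡-2 λ ()
... | Sign.+ | Sign.- | Sign.+ | Sign.- = contradiction det≡-2 λ ()
... | Sign.+ | Sign.- | Sign.- | Sign.+ = contradiction det≡-2 λ ()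
... | Sign.+ | Sign.- | Sign.- | Sign.- = contradiction det≡-2 λ ()
... | Sign.- | Sign.+ | Sign.+ | Sign.+ = contradiction det≡-2 λ ()
... | Sign.- | Sign.+ | Sign.+ | Sign.- = contradiction det≡-2 λ ()
... | Sign.- | Sign.+ | Sign.- | Sign.+ = contradiction det≡-2 λ ()
... | Sign.- | Sign.+ | Sign.- | Sign.- = contradiction det≡-2 λ ()
... | Sign.- | Sign.- | Sign.+ | Sign.+ = contradiction det≡-2 λ ()
... | Sign.- | Sign.- | Sign.+ | Sign.- = contradiction det≡-2 λ ()
... | Sign.- | Sign.- | Sign.- | Sign.+ = contradiction det≡-2 λ ()
... | Sign.- | Sign.- | Sign.- | Sign.- = contradiction det≡-2 λ ()
det≡-2⇒edgeShape 3 1 S refl _ = there (there (here refl))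
det≡-2⇒edgeShape 4 0 S refl ()

-- For a single column M of length a, eliminating the identity block leaves 1 - MᵀM = 1 - a, which
-- is -1 for a = 2 and -2 for a = 3; a single row is symmetric. Splitting on the signs lets the
-- determinants compute.
edgeShape⇒det : ∀ a b (S : SignMatrix a b) → (a , b) ∈ edgeShapes →
                (a ℕ.+ b ≡ 3 × detℤ (bordered S) ≡ -1ℤ) ⊎
                (a ℕ.+ b ≡ 4 × detℤ (bordered S) ≡ ℤ.- + 2)
edgeShape⇒det 2 1 S (here refl) with S 0F 0F | S 1F 0F
... | Sign.+ | Sign.+ = inj₁ (refl , refl)
... | Sign.+ | Sign.- = inj₁ (refl , refl)
... | Sign.- | Sign.+ = inj₁ (refl , refl)
... | Sign.- | Sign.- = inj₁ (refl , refl)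
edgeShape⇒det 1 2 S (there (here refl)) with S 0F 0F | S 0F 1F
... | Sign.+ | Sign.+ = inj₁ (refl , refl)
... | Sign.+ | Sign.- = inj₁ (refl , refl)
... | Sign.- | Sign.+ = inj₁ (refl , refl)
... | Sign.- | Sign.- = inj₁ (refl , refl)
edgeShape⇒det 3 1 S (there (there (here refl))) with S 0F 0F | S 1F 0F | S 2F 0F
... | Sign.+ | Sign.+ | Sign.+ = inj₂ (refl , refl)
... | Sign.+ | Sign.+ | Sign.- = inj₂ (refl , refl)
... | Sign.+ | Sign.- | Sign.+ = inj₂ (refl , refl)
... | Sign.+ | Sign.- | Sign.- = inj₂ (refl , refl)
... | Sign.- | Sign.+ | Sign.+ = inj₂ (refl , refl)
... | Sign.- | Sign.+ | Sign.- = inj₂ (refl , refl)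
... | Sign.- | Sign.- | Sign.+ = inj₂ (refl , refl)
... | Sign.- | Sign.- | Sign.- = inj₂ (refl , refl)
edgeShape⇒det 1 3 S (there (there (there (here refl)))) with S 0F 0F | S 0F 1F | S 0F 2F
... | Sign.+ | Sign.+ | Sign.+ = inj₂ (refl , refl)
... | Sign.+ | Sign.+ | Sign.- = inj₂ (refl , refl)
... | Sign.+ | Sign.- | Sign.+ = inj₂ (refl , refl)
... | Sign.+ | Sign.- | Sign.- = inj₂ (refl , refl)
... | Sign.- | Sign.+ | Sign.+ = inj₂ (refl , refl)
... | Sign.- | Sign.+ | Sign.- = inj₂ (refl , refl)
... | Sign.- | Sign.- | Sign.+ = inj₂ (refl , refl)
... | Sign.- | Sign.- | Sign.- = inj₂ (refl , refl)

-- The design of a real Hadamard matrix.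

module _ {c ℓ₁ ℓ₂} (R : RealNumbers c ℓ₁ ℓ₂) where
  open ComplexMatrices R
  open ComplexProperties R

  -- The entries of `H` are signs, so each principal minor is an embedded integer; injectivity of
  -- `embed` turns the conditions over ℂ into the integer equations classified by shape.
  edge⇔edgeShape : {v : ℕ} (H : Matrix v v) → IsHadamard H → IsReal H →
    let A = ⟦ I , H ∣ H ᵀ , I ⟧
        E = 𝔅 A 3 (- ι 1) ∪ 𝔅 A 4 (- ι 2)
    in (α β : Subset v) → E (α ++ β) ⇔ (∣ α ∣ , ∣ β ∣) ∈ edgeShapes
  edge⇔edgeShape {v} H hadamard real α β = mk⇔
    (λ { (inj₁ (∣αβ∣≡3 , det≈-1)) →
           det≡-1⇒edgeShape ∣ α ∣ ∣ β ∣ S′ (≡.trans (≡.sym ∣αβ∣≡) ∣αβ∣≡3) (det≈⇒≡ 1 det≈-1)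
       ; (inj₂ (∣αβ∣≡4 , det≈-2)) →
           det≡-2⇒edgeShape ∣ α ∣ ∣ β ∣ S′ (≡.trans (≡.sym ∣αβ∣≡) ∣αβ∣≡4) (det≈⇒≡ 2 det≈-2) })
    (λ shape → Sum.map (λ (a+b≡3 , det≡) → ≡.trans ∣αβ∣≡ a+b≡3 , ≡⇒det≈ 1 det≡)
                       (λ (a+b≡4 , det≡) → ≡.trans ∣αβ∣≡ a+b≡4 , ≡⇒det≈ 2 det≡)
                       (edgeShape⇒det ∣ α ∣ ∣ β ∣ S′ shape))
    where
    open IsHadamard hadamard

    M = ⟦ I , H ∣ H ᵀ , I ⟧

    ±1 : ∀ i j → ∃[ s ] H i j ≈ embed (s ◃ 1)
    ±1 i j = unimodular∧real⇒±1 (unimodular i j) (real i j)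

    S : SignMatrix v v
    S i j = proj₁ (±1 i j)

    S′ : SignMatrix ∣ α ∣ ∣ β ∣
    S′ = restrict S α β

    ∣αβ∣≡ : ∣ α ++ β ∣ ≡ ∣ α ∣ ℕ.+ ∣ β ∣
    ∣αβ∣≡ = ∣α++β∣≡∣α∣+∣β∣ α β

    det≈ : det (M [ α ++ β ]) ≈ embed (detℤ (bordered S′))
    det≈ = det≈embed-cast ∣αβ∣≡ (M [ α ++ β ]) (bordered S′) λ i j →
      ≡.subst (λ k → (M [ α ++ β ]) i j ≈ embed k) (bordered-elements S α β i j)
              (entry≈embed H S (λ x y → proj₂ (±1 x y)) (elements (α ++ β) i) (elements (α ++ β) j))

    det≈⇒≡ : ∀ k → det (M [ α ++ β ]) ≈ - ι k → detℤ (bordered S′) ≡ ℤ.- + k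
    det≈⇒≡ k det≈-k =
      embed-injective (≈-trans (≈-sym det≈) (≈-trans det≈-k (-ι≈embed k)))

    ≡⇒det≈ : ∀ k → detℤ (bordered S′) ≡ ℤ.- + k → det (M [ α ++ β ]) ≈ - ι k
    ≡⇒det≈ k det≡-k = ≈-trans det≈
      (≡.subst (λ d → embed d ≈ - ι k) (≡.sym det≡-k) (≈-sym (-ι≈embed k)))

theorem4p2 : ∀ {c ℓ₁ ℓ₂} (R : RealNumbers c ℓ₁ ℓ₂) →
    let open ComplexMatrices R in
    (v : ℕ) .{{_ : NonZero v}} (H : Matrix v v) →
    IsHadamard H →
    IsReal H →
    let A = ⟦ I , H ∣ H ᵀ , I ⟧
        E = 𝔅 A 3 (- ι 1) ∪ 𝔅 A 4 (- ι 2)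
    in
    IsPBD (v ℕ.+ v) (｛ 3 ｝ ∪ ｛ 4 ｝) (v ℕ.^ 2 ∸ v) E × IsRegular E
theorem4p2 R v H hadamard real = record
  -- Membership in `｛ 3 ｝` unfolds to `3 ≡ ∣ e ∣`, hence the reversal.
  { sizes    = λ _ → Sum.map (≡.sym ∘ proj₁) (≡.sym ∘ proj₁)
  ; balanced = balanced E edge⇔shape
  } , regular E edge⇔shape
  where
  open ComplexMatrices R
  M = ⟦ I , H ∣ H ᵀ , I ⟧
  E = 𝔅 M 3 (- ι 1) ∪ 𝔅 M 4 (- ι 2)
  edge⇔shape = edge⇔edgeShape R H hadamard real
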